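{- Let $\langle\mathfrak{B},\mathsf{C}\rangle$ be a Boolean contact algebra satisfying the extensionality condition: for every $x\in B$ with $x\neq\mathbf{0}$ there is $y\in B$ with $y\neq\mathbf{0}$ and $y\ll x$. Then the following are equivalent: (a) $\langle\mathfrak{B},\mathsf{C}\rangle$ satisfies (C4$^c$); (b) every region $x\in B$ is isolated, i.e. $x\ll x$; (c) the contact relation and the overlap relation coincide, i.e. $\mathsf{C}=\mathsf{O}$.
   Context: A Boolean contact algebra is a pair $\langle\mathfrak{B},\mathsf{C}\rangle$ where $\mathfrak{B}=\langle B,\cdot,+,-,\mathbf{0},\mathbf{1}\rangle$ is a Boolean algebra (elements of $B$ are called regions) and $\mathsf{C}\subseteq B\times B$ satisfies, for all $x,y,z\in B$: (C0) not $\mathbf{0}\mathrel{\mathsf{C}}x$; (C1) if $x\le y$ and $x\ne\mathbf{0}$, then $x\mathrel{\mathsf{C}}y$; (C2) if $x\mathrel{\mathsf{C}}y$, then $y\mathrel{\mathsf{C}}x$; (C3) if $x\le y$ and $z\mathrel{\mathsf{C}}x$, then $z\mathrel{\mathsf{C}}y$; (C4) if $x\mathrel{\mathsf{C}}(y+z)$, then $x\mathrel{\mathsf{C}}y$ or $x\mathrel{\mathsf{C}}z$. Overlap: $x\mathrel{\mathsf{O}}y\iff x\cdot y\neq\mathbf{0}$. Non-tangential part: $x\ll y$ iff not $x\mathrel{\mathsf{C}}(-y)$. (C4$^c$): for every $x\in B$ and every family $J\subseteq B$ whose supremum $\bigvee J$ exists, if $x\mathrel{\mathsf{C}}\bigvee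 J$, then there is $y\in J$ with $x\mathrel{\mathsf{C}}y$. -}

module Defs where

open import Level using (Level; suc; _⊔_)
open import Data.Product.Base using (_×_; ∃-syntax)
open import Data.Sum.Base using (_⊎_)
open import Relation.Nullary.Negation.Core using (¬_)
open import Relation.Unary using (Pred; _∈_)
open import Relation.Binary.Core using (Rel; _⇔_)
open import Relation.Binary.Bundles using (Poset)
open import Algebra.Lattice.Bundles using (BooleanAlgebra)
import Algebra.Lattice.Properties.BooleanAlgebra as BooleanAlgebraProperties

module _ {c ℓ₁ ℓ₂} (P : Poset c ℓ₁ ℓ₂) where
  open Poset P

  IsUpperBound : ∀ {p} → Pred Carrier p → Carrier → Set (c ⊔ ℓ₂ ⊔ p)
  IsUpperBound J u = ∀ y → y ∈ J → y ≤ u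

  IsSupremum : ∀ {p} → Pred Carrier p → Carrier → Set (c ⊔ ℓ₂ ⊔ p)
  IsSupremum J s = IsUpperBound J s × (∀ u → IsUpperBound J u → s ≤ u)

module _ {c ℓ} (𝔅 : BooleanAlgebra c ℓ) where
  open BooleanAlgebra 𝔅
    renaming (_∨_ to _+_; _∧_ to _·_; ¬_ to -_; ⊥ to 𝟎)
  open BooleanAlgebraProperties 𝔅 using (poset)
  -- x ≤ y is x ≈ x · y.
  open Poset poset using (_≤_)

  record IsContact {r} (_C_ : Rel Carrier r) : Set (c ⊔ ℓ ⊔ r) where
    field
      C0 : ∀ x → ¬ (𝟎 C x)
      C1 : ∀ x y → x ≤ y → x ≉ 𝟎 → x C y
      C2 : ∀ x y → x C y → y C x
      C3 : ∀ x y z → x ≤ y → z C x → z C y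
      C4 : ∀ x y z → x C (y + z) → x C y ⊎ x C z

record BooleanContactAlgebra c ℓ r : Set (suc (c ⊔ ℓ ⊔ r)) where
  infix 4 _C_
  field
    booleanAlgebra : BooleanAlgebra c ℓ
    _C_            : Rel (BooleanAlgebra.Carrier booleanAlgebra) r
    isContact      : IsContact booleanAlgebra _C_

  open BooleanAlgebra booleanAlgebra public
    renaming (_∨_ to _+_; _∧_ to _·_; ¬_ to -_; ⊥ to 𝟎; ⊤ to 𝟏)
  open BooleanAlgebraProperties booleanAlgebra public using (poset)
  open Poset poset public using (_≤_)
  open IsContact isContact public

module _ {c ℓ r} (𝔄 : BooleanContactAlgebra c ℓ r) where
  open BooleanContactAlgebra 𝔄

  Overlap : Rel Carrier ℓ
  Overlap x y = x · y ≉ 𝟎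

  NonTangentialPart : Rel Carrier r
  NonTangentialPart x y = ¬ (x C (- y))

  Isolated : Pred Carrier r
  Isolated x = NonTangentialPart x x

  Extensional : Set (c ⊔ ℓ ⊔ r)
  Extensional = ∀ x → x ≉ 𝟎 → ∃[ y ] (y ≉ 𝟎 × NonTangentialPart y x)

  -- J need not respect _≈_: closing J under _≈_ changes neither its
  -- suprema nor whether some member of J is in contact with x.
  -- The level p bounds the families quantified over; under excluded
  -- middle every predicate has an equivalent one at each level.
  C4ᶜ : (p : Level) → Set (c ⊔ ℓ ⊔ r ⊔ suc p)
  C4ᶜ p = ∀ x (J : Pred Carrier p) s → IsSupremum poset J s →
          x C s → ∃[ y ] (y ∈ J × x C y)

  AllIsolated : Set (c ⊔ r)
  AllIsolated = ∀ x → Isolated x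

  ContactIsOverlap : Set (c ⊔ ℓ ⊔ r)
  ContactIsOverlap = _C_ ⇔ Overlap

{-# OPTIONS --safe #-}

-- Two regions overlap iff their meet is nonzero, and x · y ≈ 𝟎 iff x ≤ - y.
-- Hence overlapping regions are always in contact, and C ⊆ O says exactly
-- that no x is in contact with - x.  Overlap distributes over arbitrary
-- existing suprema: if x overlaps no member of J, then - x bounds J.
-- Conversely, extensionality makes every x the supremum of its non-tangential
-- parts, and none of these is in contact with - x, so (C4ᶜ) isolates x.
module Submission where

open import Defs
open import Level using (_⊔_; Lift; lift; lower)
open import Data.Product.Base using (_×_; _,_)
open import Function.Base using (_∘_)
open import Function.Bundles using (_⇔_; mk⇔)
open import Axiom.ExcludedMiddle using (ExcludedMiddle)
open import Algebra.Lattice.Bundles using (BooleanAlgebra)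
import Algebra.Lattice.Properties.BooleanAlgebra as BooleanAlgebraProperties
open import Relation.Binary.Bundles using (Poset)
open import Relation.Nullary.Decidable
  using (Dec; False; toWitnessFalse; fromWitnessFalse; map′; decidable-stable)
open import Relation.Nullary.Negation.Core using (¬_)
open import Relation.Unary using (Pred)
import Relation.Binary.Reasoning.Setoid as ≈-Reasoning

-- Excluded middle is assumed once, at the join of all levels; this hands it down to the level of
-- each proposition decided.
lowerExcludedMiddle : ∀ {a} b → ExcludedMiddle (a ⊔ b) → ExcludedMiddle a
lowerExcludedMiddle b em {P} = map′ lower lift (em {Lift b P})

module _ {c ℓ} (𝔅 : BooleanAlgebra c ℓ) where
  open BooleanAlgebra 𝔅
    renaming (_∨_ to _+_; _∧_ to _·_; ¬_ to -_; ⊥ to 𝟎; ⊤ to 𝟏)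
  open BooleanAlgebraProperties 𝔅
  open Poset poset using (_≤_; ≤-respʳ-≈)
  open ≈-Reasoning setoid

  x·y≤x : ∀ x y → x · y ≤ x
  x·y≤x x y = begin
    x · y        ≈⟨ ∧-congʳ (∧-idem x) ⟨
    (x · x) · y  ≈⟨ ∧-assoc x x y ⟩
    x · (x · y)  ≈⟨ ∧-comm x (x · y) ⟩
    (x · y) · x  ∎

  x·y≤y : ∀ x y → x · y ≤ y
  x·y≤y x y = begin
    x · y        ≈⟨ ∧-congˡ (∧-idem y) ⟨
    x · (y · y)  ≈⟨ ∧-assoc x y y ⟨
    (x · y) · y  ∎

  x·y≈𝟎⇒x≤-y : ∀ {x y} → x · y ≈ 𝟎 → x ≤ - y
  x·y≈𝟎⇒x≤-y {x} {y} x·y≈𝟎 = begin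
    x                  ≈⟨ ∧-identityʳ x ⟨
    x · 𝟏              ≈⟨ ∧-congˡ (∨-complementʳ y) ⟨
    x · (y + - y)      ≈⟨ ∧-distribˡ-∨ x y (- y) ⟩
    x · y + x · (- y)  ≈⟨ ∨-congʳ x·y≈𝟎 ⟩
    𝟎 + x · (- y)      ≈⟨ ∨-identityˡ (x · (- y)) ⟩
    x · (- y)          ∎

  x≤-y⇒x·y≈𝟎 : ∀ {x y} → x ≤ - y → x · y ≈ 𝟎
  x≤-y⇒x·y≈𝟎 {x} {y} x≤-y = begin
    x · y            ≈⟨ ∧-congʳ x≤-y ⟩
    (x · (- y)) · y  ≈⟨ ∧-assoc x (- y) y ⟩
    x · (- y · y)    ≈⟨ ∧-congˡ (∧-complementˡ y) ⟩
    x · 𝟎            ≈⟨ ∧-zeroʳ x ⟩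
    𝟎                ∎

  x·-y≈𝟎⇒x≤y : ∀ {x y} → x · (- y) ≈ 𝟎 → x ≤ y
  x·-y≈𝟎⇒x≤y = ≤-respʳ-≈ (¬-involutive _) ∘ x·y≈𝟎⇒x≤-y

  x≤y⇒x·-y≈𝟎 : ∀ {x y} → x ≤ y → x · (- y) ≈ 𝟎
  x≤y⇒x·-y≈𝟎 = x≤-y⇒x·y≈𝟎 ∘ ≤-respʳ-≈ (sym (¬-involutive _))

  x·y≈𝟎⇒y≤-x : ∀ {x y} → x · y ≈ 𝟎 → y ≤ - x
  x·y≈𝟎⇒y≤-x = x·y≈𝟎⇒x≤-y ∘ trans (∧-comm _ _)

  -‿antitone : ∀ {x y} → x ≤ y → - y ≤ - x
  -‿antitone = x·y≈𝟎⇒y≤-x ∘ x≤y⇒x·-y≈𝟎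

module _ {c ℓ r} (𝔄 : BooleanContactAlgebra c ℓ r) where
  open BooleanContactAlgebra 𝔄
  open Poset poset using () renaming (trans to ≤-trans)

  -- The nonzero region `x · y` lies below `x`, so C1 puts it in contact with `x`; C2 and C3 then
  -- replace it by the larger `y`.
  overlap⇒contact : ∀ {x y} → Overlap 𝔄 x y → x C y
  overlap⇒contact {x} {y} xOy =
    C3 (x · y) y x (x·y≤y booleanAlgebra x y)
      (C2 (x · y) x (C1 (x · y) x (x·y≤x booleanAlgebra x y) xOy))

  -- If `x · y` were `𝟎`, then `y` would lie below `- x`, and C3 would put `x` in contact with
  -- `- x`.
  allIsolated⇒contact⇒overlap : AllIsolated 𝔄 → ∀ {x y} → x C y → Overlap 𝔄 x y
  allIsolated⇒contact⇒overlap isolated {x} {y} xCy x·y≈𝟎 =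
    isolated x (C3 y (- x) x (x·y≈𝟎⇒y≤-x booleanAlgebra x·y≈𝟎) xCy)

  contactIsOverlap⇒allIsolated : ContactIsOverlap 𝔄 → AllIsolated 𝔄
  contactIsOverlap⇒allIsolated (C⇒O , _) x xC-x = C⇒O xC-x (∧-complementʳ x)

  allIsolated⇔contactIsOverlap : AllIsolated 𝔄 ⇔ ContactIsOverlap 𝔄
  allIsolated⇔contactIsOverlap = mk⇔ {B = ContactIsOverlap 𝔄}
    (λ isolated → allIsolated⇒contact⇒overlap isolated , overlap⇒contact)
    contactIsOverlap⇒allIsolated

  allIsolated⇒C4ᶜ : ∀ p → ExcludedMiddle (c ⊔ ℓ ⊔ r ⊔ p) →
                    AllIsolated 𝔄 → C4ᶜ 𝔄 p
  allIsolated⇒C4ᶜ p em isolated x J s (_ , least) xCs =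
    decidable-stable (lowerExcludedMiddle ℓ em) λ noContact →
      allIsolated⇒contact⇒overlap isolated xCs
        (trans (∧-comm x s) (x≤-y⇒x·y≈𝟎 booleanAlgebra
          -- A member overlapping `x` would be in contact with it, so `- x` is an upper bound of `J`
          -- and leastness yields `s ≤ - x`.
          (least (- x) λ y y∈J → x·y≈𝟎⇒y≤-x booleanAlgebra
            (decidable-stable (lowerExcludedMiddle (c ⊔ r ⊔ p) em)
              λ xOy → noContact (y , y∈J , overlap⇒contact xOy)))))

  module _ (em : ExcludedMiddle (c ⊔ ℓ ⊔ r)) where

    private
      ≈-stable : ∀ {x y} → ¬ ¬ (x ≈ y) → x ≈ y
      ≈-stable = decidable-stable (lowerExcludedMiddle (c ⊔ r) em)

      contact? : ∀ x y → Dec (x C y)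
      contact? x y = lowerExcludedMiddle (c ⊔ ℓ) em

    -- Otherwise `x` would overlap `- y` and so be in contact with it.
    nonTangentialPart⇒≤ : ∀ {x y} → NonTangentialPart 𝔄 x y → x ≤ y
    nonTangentialPart⇒≤ x≪y =
      x·-y≈𝟎⇒x≤y booleanAlgebra (≈-stable (x≪y ∘ overlap⇒contact))

    nonTangentialPart-monoʳ : ∀ {x y z} → y ≤ z →
                              NonTangentialPart 𝔄 x y → NonTangentialPart 𝔄 x z
    nonTangentialPart-monoʳ {x} {y} {z} y≤z x≪y xC-z =
      x≪y (C3 (- z) (- y) x (-‿antitone booleanAlgebra y≤z) xC-z)

    -- Deciding contact moves this family from level r to the arbitrary
    -- level p over which (C4ᶜ) quantifies.
    NonTangentialParts : ∀ p → Carrier → Pred Carrier p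
    NonTangentialParts p x y = Lift p (False (contact? y (- x)))

    -- If `x · (- u)` were nonzero for an upper bound `u`, extensionality would give it a nonzero
    -- non-tangential part; that part belongs to the family, so it lies below `u` as well as below
    -- `- u`.
    extensional⇒supremum : ∀ p → Extensional 𝔄 →
                           ∀ x → IsSupremum poset (NonTangentialParts p x) x
    extensional⇒supremum p ext x =
      (λ y y∈J → nonTangentialPart⇒≤ (toWitnessFalse (lower y∈J))) ,
      λ u bound → x·-y≈𝟎⇒x≤y booleanAlgebra (≈-stable λ x·-u≉𝟎 →
        let
          z , z≉𝟎 , z≪x·-u = ext (x · (- u)) x·-u≉𝟎
          z≪x  = nonTangentialPart-monoʳ (x·y≤x booleanAlgebra x (- u)) z≪x·-u
          z≤u  = bound z (lift (fromWitnessFalse z≪x))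
          z≤-u = ≤-trans (nonTangentialPart⇒≤ z≪x·-u) (x·y≤y booleanAlgebra x (- u))
        -- `z≤u` is the equation `z ≈ z · u`, whose right side vanishes by `z≤-u`.
        in z≉𝟎 (trans z≤u (x≤-y⇒x·y≈𝟎 booleanAlgebra z≤-u)))

    C4ᶜ⇒allIsolated : ∀ p → Extensional 𝔄 → C4ᶜ 𝔄 p → AllIsolated 𝔄
    C4ᶜ⇒allIsolated p ext c4ᶜ x xC-x =
      -- C2 turns the contact around so that the supremum `x` stands on the right, where (C4ᶜ)
      -- applies.
      let y , y∈J , -xCy = c4ᶜ (- x) (NonTangentialParts p x) x
                             (extensional⇒supremum p ext x) (C2 x (- x) xC-x)
      in toWitnessFalse (lower y∈J) (C2 (- x) y -xCy)

theorem5p3 : ∀ {c ℓ r} p → ExcludedMiddle (c ⊔ ℓ ⊔ r ⊔ p) →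
    (𝔄 : BooleanContactAlgebra c ℓ r) → Extensional 𝔄 →
    (C4ᶜ 𝔄 p ⇔ AllIsolated 𝔄) × (AllIsolated 𝔄 ⇔ ContactIsOverlap 𝔄)
theorem5p3 p em 𝔄 ext =
  mk⇔ (C4ᶜ⇒allIsolated 𝔄 (lowerExcludedMiddle p em) p ext)
      (allIsolated⇒C4ᶜ 𝔄 p em) ,
  allIsolated⇔contactIsOverlap 𝔄
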